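{- Let $0<\varepsilon<1$ and $k,r\in\mathbb{N}$. For any $r$-coloring of $(0,\varepsilon)\cap\mathbb{Q}$ there exist $a$, $b$ and $d$ in $(0,\varepsilon)\cap\mathbb{Q}$ such that the set $\big\{b\cdot(a+i\cdot d)^{j}: i,j\in\{0,1,\ldots,k\}\big\}$ is monochromatic.
   Context: $\mathbb{N}=\{1,2,3,\ldots\}$. An $r$-coloring of a set $X$ is a function $X\to\{1,\ldots,r\}$; a subset is monochromatic if the coloring is constant on it. -}

module Defs where

open import Data.Nat using (ℕ; zero; suc)
open import Data.Integer using (+_)
open import Data.Rational using (ℚ; _<_; _*_; _+_; _/_; 0ℚ; 1ℚ)
open import Data.Product using (Σ; _×_)
open import Data.Fin using (Fin)

_^ℚ_ : ℚ → ℕ → ℚ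
q ^ℚ zero = 1ℚ
q ^ℚ suc j = q * (q ^ℚ j)

ℕ→ℚ : ℕ → ℚ
ℕ→ℚ i = + i / 1

InInterval : ℚ → ℚ → Set
InInterval ε q = (0ℚ < q) × (q < ε)

Interval : ℚ → Set
Interval ε = Σ ℚ (InInterval ε)

Coloring : ℕ → ℚ → Set
Coloring r ε = Interval ε → Fin r

{-# OPTIONS --safe #-}
module Submission where

-- By Hales–Jewett there is n such that, for every x = (x₁, …, xₙ), colouring the words
-- w ∈ {0,…,k}ⁿ by the colour of b₀ ∏ xₜ^{wₜ} admits a monochromatic line: in the variable j its
-- points are b₀ · (∏ over inactive t of xₜ^{wₜ}) · (∏ over active t of xₜ)ʲ. Colour each x in a
-- scaled grid by the whole induced colouring of words. A second use of Hales–Jewett, with letters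
-- (t , i) standing for i times the t-th unit vector, gives a point p and a step δ such that moving
-- p by i δ (i ≤ k) along any single axis keeps the induced colouring. Take the line belonging to p
-- and move p along one active axis: the inactive factor does not change, and the product over the
-- active coordinates runs through an arithmetic progression.

open import Defs
open import Data.Nat as ℕ using (ℕ; zero; suc; _≤_; _≥_; z≤n; s≤s)
open import Data.Rational as ℚ using (ℚ; _<_; _*_; _+_; 0ℚ; 1ℚ; 1/_; Positive; NonZero; positive; nonNegative)
open import Data.Rational.Properties using (_<?_; ≤-refl; ≤-trans; <-trans; ≤-<-trans; <⇒≤; +-identityˡ; +-identityʳ; +-monoˡ-<; +-monoʳ-<; *-assoc; *-comm; *-identityˡ; *-identityʳ; *-zeroˡ; *-inverseˡ; *-monoˡ-≤-nonNeg; *-monoʳ-<-pos; pos*pos⇒pos; positive⁻¹; pos⇒nonZero; 1/pos⇒pos; normalize-pos; toℚᵘ-injective; toℚᵘ-fromℚᵘ; toℚᵘ-homo-+; toℚᵘ-homo-*)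
open import Data.Rational.Solver using (module +-*-Solver)
open import Data.Rational.Unnormalised using (mkℚᵘ; *≡*)
import Data.Rational.Unnormalised.Properties as ℚᵘ
open import Data.Fin using (Fin; zero; suc; _≟_; funToFin; finToFun; combine; remQuot; toℕ; fromℕ<; _↑ˡ_; _↑ʳ_)
open import Data.Fin.Properties using (finToFun-funToFin; pigeonhole; any?; <⇒≢; remQuot-combine; toℕ≤pred[n]; toℕ-fromℕ<)
open import Data.Maybe as Maybe using (Maybe; just; nothing; fromMaybe)
import Data.Nat.Properties as ℕ
import Data.Integer as ℤ
import Data.Integer.Properties as ℤ
open import Algebra.Properties.CommutativeSemigroup ℕ.+-commutativeSemigroup using (x∙yz≈y∙xz)
open import Data.Product using (Σ; ∃; _×_; _,_; proj₁; proj₂)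
open import Data.Sum using (_⊎_; inj₁; inj₂)
open import Data.Vec using (Vec; []; _∷_; _++_; lookup; map; tabulate; updateAt; replicate)
open import Data.Vec.Relation.Unary.All as All using (All; []; _∷_)
open import Data.Vec.Relation.Unary.All.Properties using (lookup⁺)
open import Data.Vec.Properties using (lookup-++ˡ; lookup-++ʳ; lookup-map; map-++; map-∘; map-id; map-cong; tabulate-cong; tabulate∘lookup; updateAt-id; updateAt-updateAt-local; lookup∘updateAt)
open import Relation.Binary.PropositionalEquality using (_≡_; _≢_; refl; sym; trans; cong; cong₂; subst; subst₂)
open import Relation.Nullary using (yes; no; contradiction; _×-dec_)

open +-*-Solver using (solve; _:*_; _:+_; _:=_)

private
  variable
    A B : Set
    k m n r : ℕ

-- Coding colourings of words as colours.

-- Makes a colouring of words usable as a colour.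
code : (Vec (Fin m) n → Fin r) → Fin (r ℕ.^ (m ℕ.^ n))
code f = funToFin (λ i → f (tabulate (finToFun i)))

-- The word `u` is decoded from its own index, and equal codes agree at that index.
code-injective : (f g : Vec (Fin m) n → Fin r) → code f ≡ code g → ∀ u → f u ≡ g u
code-injective {m} {n} f g eq u =
  subst (λ v → f v ≡ g v) decode
    (trans (sym (finToFun-funToFin _ i)) (trans (cong (λ e → finToFun e i) eq) (finToFun-funToFin _ i)))
  where
  i : Fin (m ℕ.^ n)
  i = funToFin (lookup u)
  decode : tabulate (finToFun i) ≡ u
  decode = trans (tabulate-cong (finToFun-funToFin (lookup u))) (tabulate∘lookup u)

-- Combinatorial lines.

-- A combinatorial line; the active coordinates are those holding `nothing`.
record Line (A : Set) (n : ℕ) : Set where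
  constructor line
  field
    template : Vec (Maybe A) n
    active   : ∃ λ t → lookup template t ≡ nothing

open Line

fill : Vec (Maybe A) n → A → Vec A n
fill L a = map (fromMaybe a) L

_at_ : Line A n → A → Vec A n
L at a = fill (template L) a

Monochromatic : (Vec A n → B) → Line A n → Set
Monochromatic c L = ∀ x y → c (L at x) ≡ c (L at y)

fill-just : (u : Vec A n) (a : A) → fill (map just u) a ≡ u
fill-just u a = trans (sym (map-∘ _ _ u)) (map-id u)

fill-map : (f : A → B) (L : Vec (Maybe A) n) (a : A) →
  fill (map (Maybe.map f) L) (f a) ≡ map f (fill L a)
fill-map f L a =
  trans (sym (map-∘ _ _ L))
    (trans (map-cong (λ { (just _) → refl ; nothing → refl }) L) (map-∘ f (fromMaybe a) L))

-- Only the left block must have an active coordinate, so the right block may be a constant word or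
-- the template of another line; `refocus` uses both.
_⊞_ : Line A m → Vec (Maybe A) n → Line A (m ℕ.+ n)
line L (t , eq) ⊞ M = line (L ++ M) (t ↑ˡ _ , trans (lookup-++ˡ L M t) eq)

⊞-at : (L : Line A m) (M : Vec (Maybe A) n) (a : A) → (L ⊞ M) at a ≡ L at a ++ fill M a
⊞-at L M a = map-++ _ (template L) M

prefix : Vec A m → Line A n → Line A (m ℕ.+ n)
prefix u (line L (t , eq)) = line (map just u ++ L) (_ ↑ʳ t , trans (lookup-++ʳ (map just u) L t) eq)

prefix-at : (u : Vec A m) (L : Line A n) (a : A) → prefix u L at a ≡ u ++ L at a
prefix-at u L a = trans (map-++ _ (map just u) (template L)) (cong (_++ _) (fill-just u a))

mapLine : (A → B) → Line A n → Line B n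
mapLine f (line L (t , eq)) =
  line (map (Maybe.map f) L) (t , trans (lookup-map t _ L) (cong (Maybe.map f) eq))

-- The Hales-Jewett theorem by colour focusing.

-- Lines that all reach `focus` at the new letter 0 and are monochromatic, in
-- pairwise distinct colours, on the old letters.
record Focused (c : Vec (Fin (suc k)) n → Fin r) (s : ℕ) : Set where
  field
    focus     : Vec (Fin (suc k)) n
    lines     : Fin s → Line (Fin (suc k)) n
    ends      : ∀ i → lines i at zero ≡ focus
    colour    : Fin s → Fin r
    mono      : ∀ i x → c (lines i at suc x) ≡ colour i
    injective : ∀ i j → colour i ≡ colour j → i ≡ j

open Focused

HalesJewett : ℕ → ℕ → Set
HalesJewett k r = ∃ λ n → (c : Vec (Fin k) n → Fin r) → ∃ (Monochromatic c)

-- At letter 0 every line of `F` meets the focus, so a line with the colour of the focus stays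
-- monochromatic over the enlarged alphabet.
absorb : (c : Vec (Fin (suc k)) n → Fin r) {s : ℕ} (F : Focused c s) (i : Fin s) →
  colour F i ≡ c (focus F) → Monochromatic c (lines F i)
absorb c F i eq x y = trans (to x) (sym (to y))
  where
  to : ∀ x → c (lines F i at x) ≡ colour F i
  to zero    = trans (cong c (ends F i)) (sym eq)
  to (suc x) = mono F i x

module _ (c : Vec (Fin (suc (suc k))) (m ℕ.+ n) → Fin r) (L : Line (Fin (suc k)) m) where

  section : Vec (Fin (suc (suc k))) n → Fin r
  section u = c (map suc (L at zero) ++ u)

  -- By `same`, the first block does not affect colours at old letters. So `L⁺` joined to an old
  -- line keeps that line's colour, while `L⁺` joined to the constant focus takes the colour of the
  -- focus under `section`, which differs from the others by hypothesis.
  refocus : (∀ x u → c (map suc (L at x) ++ u) ≡ section u) →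
    ∀ {s} (F : Focused section s) → (∀ i → colour F i ≢ section (focus F)) → Focused c (suc s)
  refocus same F new = record
    { focus     = L⁺ at zero ++ focus F
    ; lines     = λ i → L⁺ ⊞ tails i
    ; ends      = λ { zero    → trans (⊞-at L⁺ _ zero) (cong (L⁺ at zero ++_) (fill-just (focus F) zero))
                    ; (suc i) → trans (⊞-at L⁺ _ zero) (cong (L⁺ at zero ++_) (ends F i)) }
    ; colour    = colour′
    ; mono      = λ { zero x    → trans (old (map just (focus F)) x) (cong section (fill-just (focus F) (suc x)))
                    ; (suc i) x → trans (old (template (lines F i)) x) (mono F i x) }
    ; injective = λ { zero zero _       → refl
                    ; zero (suc j) eq    → contradiction (sym eq) (new j)
                    ; (suc i) zero eq    → contradiction eq (new i)
                    ; (suc i) (suc j) eq → cong suc (injective F i j eq) }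
    }
    where
    L⁺ = mapLine suc L
    tails : Fin (suc _) → Vec (Maybe (Fin (suc (suc k)))) n
    tails zero    = map just (focus F)
    tails (suc i) = template (lines F i)
    colour′ : Fin (suc _) → Fin r
    colour′ zero    = section (focus F)
    colour′ (suc i) = colour F i
    old : ∀ M x → c ((L⁺ ⊞ M) at suc x) ≡ section (fill M (suc x))
    old M x = trans (cong c (trans (⊞-at L⁺ M (suc x)) (cong (_++ _) (fill-map suc (template L) x))))
                (same x _)

-- Induction on the number `s` of focused lines. The first block is long enough for a line over the
-- old alphabet along which the induced colouring of the second block is constant; the second block
-- supplies the `s` lines already found.
focusing : (∀ r → HalesJewett (suc k) r) → ∀ r s →
  ∃ λ n → (c : Vec (Fin (suc (suc k))) n → Fin r) → ∃ (Monochromatic c) ⊎ Focused c s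
focusing hj r zero = 0 , λ c → inj₂ record
  { focus = [] ; lines = λ () ; ends = λ () ; colour = λ () ; mono = λ () ; injective = λ () }
focusing {k} hj r (suc s) = m₁ ℕ.+ n₁ , extend
  where
  smaller = focusing hj r s
  n₁ = proj₁ smaller
  -- One colour for each `r`-colouring of the words of length `n₁` over the enlarged alphabet.
  large = hj (r ℕ.^ (suc (suc k) ℕ.^ n₁))
  m₁ = proj₁ large
  extend : (c : Vec (Fin (suc (suc k))) (m₁ ℕ.+ n₁) → Fin r) → ∃ (Monochromatic c) ⊎ Focused c (suc s)
  extend c with proj₂ large (λ v → code (λ u → c (map suc v ++ u)))
  ... | L , L-mono with proj₂ smaller (section c L)
  ... | inj₁ (M , M-mono) = inj₁ (prefix (map suc (L at zero)) M , λ x y →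
        trans (cong c (prefix-at _ M x)) (trans (M-mono x y) (sym (cong c (prefix-at _ M y)))))
  ... | inj₂ F with any? (λ i → colour F i ≟ section c L (focus F))
  ... | yes (i , eq) = inj₁ (prefix (map suc (L at zero)) (lines F i) , λ x y →
        trans (cong c (prefix-at _ (lines F i) x))
          (trans (absorb (section c L) F i eq x y) (sym (cong c (prefix-at _ (lines F i) y)))))
  ... | no new = inj₂ (refocus c L (λ x → code-injective _ _ (L-mono x zero)) F (λ i eq → new (i , eq)))

-- Induction on the alphabet: `suc r` focused lines would need `suc r` distinct colours, so
-- `focusing` must have found a monochromatic line.
hales-jewett : ∀ k r → HalesJewett (suc k) r
hales-jewett zero r = 1 , λ c → line (nothing ∷ []) (zero , refl) , λ { zero zero → refl }
hales-jewett (suc k) r with focusing (hales-jewett k) r (suc r)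
... | n , dichotomy = n , λ c → conclude c (dichotomy c)
  where
  conclude : (c : Vec (Fin (suc (suc k))) n → Fin r) → ∃ (Monochromatic c) ⊎ Focused c (suc r) → ∃ (Monochromatic c)
  conclude c (inj₁ found) = found
  conclude c (inj₂ F) with pigeonhole (ℕ.n<1+n r) (colour F)
  ... | i , j , i<j , eq = contradiction (injective F i j eq) (<⇒≢ i<j)

-- Monochromatic stars in the integer grid.

bump : Fin n → ℕ → Vec ℕ n → Vec ℕ n
bump t v p = updateAt p t (v ℕ.+_)

bump-comm : ∀ (s t : Fin n) u v p → bump s u (bump t v p) ≡ bump t v (bump s u p)
bump-comm zero    zero    u v (x ∷ p) = cong (_∷ p) (x∙yz≈y∙xz u v x)
bump-comm zero    (suc t) u v (x ∷ p) = refl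
bump-comm (suc s) zero    u v (x ∷ p) = refl
bump-comm (suc s) (suc t) u v (x ∷ p) = cong (x ∷_) (bump-comm s t u v p)

bump-+ : ∀ (t : Fin n) u v p → bump t u (bump t v p) ≡ bump t (u ℕ.+ v) p
bump-+ t u v p = updateAt-updateAt-local t p (sym (ℕ.+-assoc u v _))

Bounded : ℕ → Vec ℕ n → Set
Bounded M = All (λ x → 1 ≤ x × x ≤ M)

bump-bounded : ∀ {M} u {v} → v ≤ u → ∀ (t : Fin n) {p} → Bounded M p → Bounded (u ℕ.+ M) (bump t v p)
bump-bounded u {v} v≤u zero    ((1≤x , x≤M) ∷ bs) =
  (ℕ.≤-trans 1≤x (ℕ.m≤n+m _ v) , ℕ.+-mono-≤ v≤u x≤M) ∷ All.map (λ (l , h) → l , ℕ.≤-trans h (ℕ.m≤n+m _ u)) bs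
bump-bounded u v≤u (suc t) ((1≤x , x≤M) ∷ bs) =
  (1≤x , ℕ.≤-trans x≤M (ℕ.m≤n+m _ u)) ∷ bump-bounded u v≤u t bs

-- A letter encodes a pair (t , i), contributing i times the t-th unit vector.
module Letters (n k : ℕ) where

  private
    Letter = Fin (n ℕ.* suc k)

  push : Letter → Vec ℕ n → Vec ℕ n
  push l = bump (proj₁ (remQuot (suc k) l)) (toℕ (proj₂ (remQuot {n} (suc k) l)))

  -- Starting from the all-ones vector keeps every entry at least 1, hence positive after scaling.
  total : Vec Letter m → Vec ℕ n
  total []      = replicate n 1
  total (l ∷ W) = push l (total W)

  base : Vec (Maybe Letter) m → Vec ℕ n
  base []            = replicate n 1
  base (just l ∷ L)  = push l (base L)
  base (nothing ∷ L) = base L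

  activeCount : Vec (Maybe Letter) m → ℕ
  activeCount []            = 0
  activeCount (just _ ∷ L)  = activeCount L
  activeCount (nothing ∷ L) = suc (activeCount L)

  activeCount-positive : (L : Vec (Maybe Letter) m) (t : Fin m) → lookup L t ≡ nothing → 1 ≤ activeCount L
  activeCount-positive (nothing ∷ L) _       _  = s≤s z≤n
  activeCount-positive (just _ ∷ L)  (suc t) eq = activeCount-positive L t eq

  push-combine : ∀ t i p → push (combine t i) p ≡ bump t (toℕ i) p
  push-combine t i p = cong (λ (s , j) → bump s (toℕ j) p) (remQuot-combine t i)

  -- Each active coordinate adds `i` to entry `t`, so the step is the number of active coordinates,
  -- the same for every axis.
  total-fill : (L : Vec (Maybe Letter) m) (t : Fin n) (i : Fin (suc k)) →
    total (fill L (combine t i)) ≡ bump t (activeCount L ℕ.* toℕ i) (base L)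
  total-fill []            t i = sym (updateAt-id t _)
  total-fill (just l ∷ L)  t i = trans (cong (push l) (total-fill L t i)) (bump-comm _ t _ _ (base L))
  total-fill (nothing ∷ L) t i =
    trans (push-combine t i _) (trans (cong (bump t (toℕ i)) (total-fill L t i)) (bump-+ t _ _ (base L)))

  replicate-bounded : ∀ j → Bounded 1 (replicate j 1)
  replicate-bounded zero    = []
  replicate-bounded (suc j) = (s≤s z≤n , s≤s z≤n) ∷ replicate-bounded j

  total-bounded : (W : Vec Letter m) → Bounded (m ℕ.* k ℕ.+ 1) (total W)
  total-bounded []            = replicate-bounded n
  total-bounded {suc m} (l ∷ W) = subst (λ M → Bounded M (total (l ∷ W))) (sym (ℕ.+-assoc k (m ℕ.* k) 1))
    (bump-bounded k (toℕ≤pred[n] _) _ (total-bounded W))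

-- A monochromatic line over the letters (t , i) maps under `total` to a star, whose centre `p`
-- comes from the letters (t , 0). The bound `M` precedes the colouring, so it can fix the scale of
-- the grid.
star : ∀ n k r → ∃ λ M → (c : Vec ℕ (suc n) → Fin r) →
  Σ (Vec ℕ (suc n)) λ p → Σ ℕ λ d → 1 ≤ d ×
    (∀ t i → i ≤ k → Bounded M (bump t (d ℕ.* i) p) × c (bump t (d ℕ.* i) p) ≡ c p)
-- Each of the `D` letters adds at most `k` to an entry that starts at 1.
star n k r = D ℕ.* k ℕ.+ 1 , λ c → conclude c (proj₂ hj (λ W → c (total W)))
  where
  open Letters (suc n) k
  -- The successor of this argument computes to `suc n ℕ.* suc k`, the number of letters.
  hj = hales-jewett (k ℕ.+ n ℕ.* suc k) r
  D = proj₁ hj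
  conclude : (c : Vec ℕ (suc n) → Fin r) → ∃ (Monochromatic (λ W → c (total {D} W))) → _
  conclude c (L , mono) = p , d ,
    activeCount-positive (template L) (proj₁ (active L)) (proj₂ (active L)) , λ t i i≤k →
      let eq = reach t i i≤k in
      subst (Bounded (D ℕ.* k ℕ.+ 1)) eq (total-bounded (L at combine t (fromℕ< (s≤s i≤k)))) ,
      trans (cong c (sym eq)) (trans (mono _ _) (cong c start))
    where
    p = base (template L)
    d = activeCount (template L)
    reach : ∀ t i (i≤k : i ≤ k) → total (L at combine t (fromℕ< (s≤s i≤k))) ≡ bump t (d ℕ.* i) p
    reach t i i≤k = trans (total-fill (template L) t _)
      (cong (λ j → bump t (d ℕ.* j) p) (toℕ-fromℕ< (s≤s i≤k)))
    start : total (L at combine {suc n} zero zero) ≡ p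
    start = trans (total-fill (template L) zero zero)
      (trans (cong (λ v → bump zero v p) (ℕ.*-zeroʳ d)) (updateAt-id zero p))

-- Monomials along a combinatorial line.

^ℚ-distrib-* : ∀ p q j → (p * q) ^ℚ j ≡ p ^ℚ j * q ^ℚ j
^ℚ-distrib-* p q zero    = refl
^ℚ-distrib-* p q (suc j) = trans (cong (p * q *_) (^ℚ-distrib-* p q j))
  (solve 4 (λ p q x y → p :* q :* (x :* y) := p :* x :* (q :* y)) refl p q (p ^ℚ j) (q ^ℚ j))

module Weights (g : ℕ → ℚ) where

  weight : Vec ℕ n → Vec (Fin m) n → ℚ
  weight []       []       = 1ℚ
  weight (x ∷ xs) (j ∷ js) = g x ^ℚ toℕ j * weight xs js

  fixed : Vec ℕ n → Vec (Maybe (Fin m)) n → ℚ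
  fixed []       []            = 1ℚ
  fixed (x ∷ xs) (just j ∷ L)  = g x ^ℚ toℕ j * fixed xs L
  fixed (x ∷ xs) (nothing ∷ L) = fixed xs L

  moving : Vec ℕ n → Vec (Maybe (Fin m)) n → ℚ
  moving []       []            = 1ℚ
  moving (x ∷ xs) (just _ ∷ L)  = moving xs L
  moving (x ∷ xs) (nothing ∷ L) = g x * moving xs L

  -- For an active coordinate `t`, the cofactor of its variable in `moving`.
  movingExcept : Fin n → Vec ℕ n → Vec (Maybe (Fin m)) n → ℚ
  movingExcept zero    (x ∷ xs) (_ ∷ L)       = moving xs L
  movingExcept (suc t) (x ∷ xs) (just _ ∷ L)  = movingExcept t xs L
  movingExcept (suc t) (x ∷ xs) (nothing ∷ L) = g x * movingExcept t xs L

  -- The active coordinates share the exponent `j`, so their factors collect into one power.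
  weight-fill : (xs : Vec ℕ n) (L : Vec (Maybe (Fin m)) n) (j : Fin m) →
    weight xs (fill L j) ≡ fixed xs L * moving xs L ^ℚ toℕ j
  weight-fill []       []            j = sym (trans (*-identityˡ _) (one^ (toℕ j)))
    where
    one^ : ∀ j → 1ℚ ^ℚ j ≡ 1ℚ
    one^ zero    = refl
    one^ (suc j) = trans (*-identityˡ _) (one^ j)
  weight-fill (x ∷ xs) (just i ∷ L)  j =
    trans (cong (g x ^ℚ toℕ i *_) (weight-fill xs L j)) (sym (*-assoc (g x ^ℚ toℕ i) _ _))
  weight-fill (x ∷ xs) (nothing ∷ L) j =
    trans (cong (g x ^ℚ toℕ j *_) (weight-fill xs L j))
      (trans (solve 3 (λ p q r → p :* (q :* r) := q :* (p :* r)) refl (g x ^ℚ toℕ j) (fixed xs L) _)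
        (cong (fixed xs L *_) (sym (^ℚ-distrib-* (g x) (moving xs L) (toℕ j)))))

  fixed-updateAt : ∀ f (t : Fin n) (xs : Vec ℕ n) (L : Vec (Maybe (Fin m)) n) → lookup L t ≡ nothing →
    fixed (updateAt xs t f) L ≡ fixed xs L
  fixed-updateAt f zero    (x ∷ xs) (nothing ∷ L) eq = refl
  fixed-updateAt f (suc t) (x ∷ xs) (just j ∷ L)  eq = cong (g x ^ℚ toℕ j *_) (fixed-updateAt f t xs L eq)
  fixed-updateAt f (suc t) (x ∷ xs) (nothing ∷ L) eq = fixed-updateAt f t xs L eq

  -- `moving` is linear in the factor at an active coordinate; this turns a progression in one entry
  -- into a progression of products.
  moving-updateAt : ∀ f (t : Fin n) (xs : Vec ℕ n) (L : Vec (Maybe (Fin m)) n) → lookup L t ≡ nothing →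
    moving (updateAt xs t f) L ≡ movingExcept t xs L * g (f (lookup xs t))
  moving-updateAt f zero    (x ∷ xs) (nothing ∷ L) eq = *-comm (g (f x)) _
  moving-updateAt f (suc t) (x ∷ xs) (just j ∷ L)  eq = moving-updateAt f t xs L eq
  moving-updateAt f (suc t) (x ∷ xs) (nothing ∷ L) eq =
    trans (cong (g x *_) (moving-updateAt f t xs L eq)) (sym (*-assoc (g x) _ _))

-- Bounds on products.

-- The endpoint 1 admits empty products and zeroth powers.
HalfOpenUnit : ℚ → Set
HalfOpenUnit q = 0ℚ < q × q ℚ.≤ 1ℚ

*-positive : ∀ {p q} → 0ℚ < p → 0ℚ < q → 0ℚ < p * q
*-positive {p} {q} 0<p 0<q = positive⁻¹ (p * q) {{pos*pos⇒pos p {{positive 0<p}} q {{positive 0<q}}}}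

p*q≤p : ∀ {p q} → 0ℚ < p → q ℚ.≤ 1ℚ → p * q ℚ.≤ p
p*q≤p {p} {q} 0<p q≤1 =
  subst (p * q ℚ.≤_) (*-identityʳ p) (*-monoˡ-≤-nonNeg p {{nonNegative (<⇒≤ 0<p)}} q≤1)

*-interval : ∀ {ε p q} → InInterval ε p → HalfOpenUnit q → InInterval ε (p * q)
*-interval (0<p , p<ε) (0<q , q≤1) = *-positive 0<p 0<q , ≤-<-trans (p*q≤p 0<p q≤1) p<ε

*-unit : ∀ {p q} → HalfOpenUnit p → HalfOpenUnit q → HalfOpenUnit (p * q)
*-unit (0<p , p≤1) (0<q , q≤1) = *-positive 0<p 0<q , ≤-trans (p*q≤p 0<p q≤1) p≤1

1-unit : HalfOpenUnit 1ℚ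
1-unit = positive⁻¹ 1ℚ , ≤-refl

^-unit : ∀ {p} j → HalfOpenUnit p → HalfOpenUnit (p ^ℚ j)
^-unit zero    u = 1-unit
^-unit (suc j) u = *-unit u (^-unit j u)

module _ {g : ℕ → ℚ} {M : ℕ} (unit : ∀ {x} → 1 ≤ x → x ≤ M → HalfOpenUnit (g x)) where

  open Weights g

  fixed-unit : {xs : Vec ℕ n} → Bounded M xs → (L : Vec (Maybe (Fin m)) n) → HalfOpenUnit (fixed xs L)
  fixed-unit []             []            = 1-unit
  fixed-unit ((l , h) ∷ bs) (just j ∷ L)  = *-unit (^-unit (toℕ j) (unit l h)) (fixed-unit bs L)
  fixed-unit (_ ∷ bs)       (nothing ∷ L) = fixed-unit bs L

  moving-unit : {xs : Vec ℕ n} → Bounded M xs → (L : Vec (Maybe (Fin m)) n) → HalfOpenUnit (moving xs L)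
  moving-unit []             []            = 1-unit
  moving-unit (_ ∷ bs)       (just j ∷ L)  = moving-unit bs L
  moving-unit ((l , h) ∷ bs) (nothing ∷ L) = *-unit (unit l h) (moving-unit bs L)

  movingExcept-unit : ∀ t {xs : Vec ℕ n} → Bounded M xs → (L : Vec (Maybe (Fin m)) n) →
    HalfOpenUnit (movingExcept t xs L)
  movingExcept-unit zero    (_ ∷ bs)       (_ ∷ L)       = moving-unit bs L
  movingExcept-unit (suc t) (_ ∷ bs)       (just j ∷ L)  = movingExcept-unit t bs L
  movingExcept-unit (suc t) ((l , h) ∷ bs) (nothing ∷ L) = *-unit (unit l h) (movingExcept-unit t bs L)

-- Scaling the integer grid into the interval.

ℕ→ℚ-homo-+ : ∀ m n → ℕ→ℚ (m ℕ.+ n) ≡ ℕ→ℚ m + ℕ→ℚ n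
ℕ→ℚ-homo-+ m n = toℚᵘ-injective (ℚᵘ.≃-trans (toℚᵘ-fromℚᵘ (mkℚᵘ (ℤ.+ (m ℕ.+ n)) 0))
  (ℚᵘ.≃-trans (*≡* (cong (ℤ._* ℤ.+ 1) (sym (cong₂ ℤ._+_ (ℤ.*-identityʳ (ℤ.+ m)) (ℤ.*-identityʳ (ℤ.+ n))))))
    (ℚᵘ.≃-sym (ℚᵘ.≃-trans (toℚᵘ-homo-+ (ℕ→ℚ m) (ℕ→ℚ n))
      (ℚᵘ.+-cong (toℚᵘ-fromℚᵘ (mkℚᵘ (ℤ.+ m) 0)) (toℚᵘ-fromℚᵘ (mkℚᵘ (ℤ.+ n) 0)))))))

ℕ→ℚ-homo-* : ∀ m n → ℕ→ℚ (m ℕ.* n) ≡ ℕ→ℚ m * ℕ→ℚ n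
ℕ→ℚ-homo-* m n = toℚᵘ-injective (ℚᵘ.≃-trans (toℚᵘ-fromℚᵘ (mkℚᵘ (ℤ.+ (m ℕ.* n)) 0))
  (ℚᵘ.≃-trans (*≡* (cong (ℤ._* ℤ.+ 1) (ℤ.pos-* m n)))
    (ℚᵘ.≃-sym (ℚᵘ.≃-trans (toℚᵘ-homo-* (ℕ→ℚ m) (ℕ→ℚ n))
      (ℚᵘ.*-cong (toℚᵘ-fromℚᵘ (mkℚᵘ (ℤ.+ m) 0)) (toℚᵘ-fromℚᵘ (mkℚᵘ (ℤ.+ n) 0)))))))

ℕ→ℚ-positive : ∀ {n} → 1 ≤ n → 0ℚ < ℕ→ℚ n
ℕ→ℚ-positive {suc n} _ = positive⁻¹ (ℕ→ℚ (suc n)) {{normalize-pos (suc n) 1}}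

ℕ→ℚ-mono-< : ∀ {m n} → m ℕ.< n → ℕ→ℚ m < ℕ→ℚ n
ℕ→ℚ-mono-< {m} {n} m<n = subst₂ _<_ (+-identityʳ (ℕ→ℚ m))
  (trans (sym (ℕ→ℚ-homo-+ m (n ℕ.∸ m))) (cong ℕ→ℚ (ℕ.m+[n∸m]≡n (ℕ.<⇒≤ m<n))))
  (+-monoʳ-< (ℕ→ℚ m) (ℕ→ℚ-positive (ℕ.m<n⇒0<n∸m m<n)))

scale : ∀ {ε} → 0ℚ < ε → (M : ℕ) → Σ ℚ λ η → 0ℚ < η × ((x : ℕ) → 1 ≤ x → x ≤ M → InInterval ε (η * ℕ→ℚ x))
scale {ε} 0<ε M = η , positive⁻¹ η , λ x 1≤x x≤M →
  *-positive (positive⁻¹ η) (ℕ→ℚ-positive 1≤x) ,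
  subst (η * ℕ→ℚ x <_) η*q≡ε (*-monoʳ-<-pos η (ℕ→ℚ-mono-< (s≤s x≤M)))
  where
  -- Dividing `ε` by M + 1 rather than M keeps the grid point `M` strictly below `ε`.
  q = ℕ→ℚ (suc M)
  instance
    q-pos : Positive q
    q-pos = normalize-pos (suc M) 1
    q-nonZero : NonZero q
    q-nonZero = pos⇒nonZero q
  η = ε * 1/ q
  instance
    η-pos : Positive η
    η-pos = pos*pos⇒pos ε {{positive 0<ε}} (1/ q) {{1/pos⇒pos q}}
  η*q≡ε : η * q ≡ ε
  η*q≡ε = trans (*-assoc ε (1/ q) q) (trans (cong (ε *_) (*-inverseˡ q)) (*-identityʳ ε))

-- From grid points to the coloured interval.

-- Colouring all of ℚ, with a junk colour off the interval, avoids carrying membership proofs.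
total-colouring : ∀ {ε} → Fin r → Coloring r ε → ℚ → Fin r
total-colouring {ε = ε} default χ q with (0ℚ <? q) ×-dec (q <? ε)
... | yes q∈ = χ (q , q∈)
... | no  _  = default

-- Since `χ` takes a membership proof, the result carries the proof found by the decision rather
-- than the given one.
total-colouring-spec : ∀ {ε} (default : Fin r) (χ : Coloring r ε) {q col} → InInterval ε q →
  total-colouring default χ q ≡ col → Σ (InInterval ε q) λ q∈ → χ (q , q∈) ≡ col
total-colouring-spec {ε = ε} default χ {q} q∈ eq with (0ℚ <? q) ×-dec (q <? ε)
... | yes q∈′ = q∈′ , eq
... | no  q∉  = contradiction q∈ q∉

theorem2 : (ε : ℚ) → 0ℚ < ε → ε < 1ℚ → (k r : ℕ) → k ≥ 1 → r ≥ 1 →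
    (χ : Coloring r ε) →
    Σ ℚ λ a → Σ ℚ λ b → Σ ℚ λ d →
    InInterval ε a × InInterval ε b × InInterval ε d ×
    Σ (Fin r) λ col →
    (i j : ℕ) → i ≤ k → j ≤ k →
    Σ (InInterval ε (b * ((a + ℕ→ℚ i * d) ^ℚ j))) λ p →
    χ (b * ((a + ℕ→ℚ i * d) ^ℚ j) , p) ≡ col
theorem2 ε 0<ε ε<1 k r k≥1 r≥1 χ with hales-jewett k r
-- Words of length 0 have no active coordinate; any colouring, here a constant one, exposes the
-- contradiction.
... | zero , hj = contradiction (proj₁ (active (proj₁ (hj (λ _ → fromℕ< r≥1))))) λ ()
... | suc n , hj =
  a , b , d , a∈ , b∈ , d∈ , col , λ i j i≤k j≤k →
    total-colouring-spec default χ (term∈ i j i≤k) (coloured i j i≤k j≤k)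
  where
  default = fromℕ< r≥1
  χ′ = total-colouring default χ
  vdW = star n k (r ℕ.^ (suc k ℕ.^ suc n))
  M = proj₁ vdW
  scaling = scale 0<ε M
  η = proj₁ scaling
  g : ℕ → ℚ
  g x = η * ℕ→ℚ x
  open Weights g
  -- The factor `g 1` lies in (0, ε), so the product stays below `ε` even when the monomial equals
  -- 1.
  colouring : Vec ℕ (suc n) → Vec (Fin (suc k)) (suc n) → Fin r
  colouring x w = χ′ (g 1 * weight x w)
  found = proj₂ vdW (λ x → code (colouring x))
  p = proj₁ found
  δ = proj₁ (proj₂ found)
  δ≥1 = proj₁ (proj₂ (proj₂ found))
  same = proj₂ (proj₂ (proj₂ found))
  L = proj₁ (hj (colouring p))
  L-mono = proj₂ (hj (colouring p))
  T = template L
  t = proj₁ (active L)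
  t-active = proj₂ (active L)
  x : ℕ → Vec ℕ (suc n)
  x i = bump t (δ ℕ.* i) p
  x-bounded : ∀ i → i ≤ k → Bounded M (x i)
  x-bounded i i≤k = proj₁ (same t i i≤k)
  p-bounded : Bounded M p
  p-bounded = subst (Bounded M) (trans (cong (λ v → bump t v p) (ℕ.*-zeroʳ δ)) (updateAt-id t p)) (x-bounded 0 z≤n)
  unit : ∀ {y} → 1 ≤ y → y ≤ M → HalfOpenUnit (g y)
  unit 1≤y y≤M = let 0<gy , gy<ε = proj₂ (proj₂ scaling) _ 1≤y y≤M in 0<gy , <⇒≤ (<-trans gy<ε ε<1)
  -- Moving `p` by δ i along axis `t` gives the active product c η (pₜ + i δ), whence the start `a`
  -- and the difference `d`.
  c = movingExcept t p T
  a = c * g (lookup p t)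
  d = c * g δ
  b = g 1 * fixed p T
  col = colouring p (L at zero)
  progression : ∀ i → moving (x i) T ≡ a + ℕ→ℚ i * d
  progression i = trans (moving-updateAt (δ ℕ.* i ℕ.+_) t p T t-active)
    (trans (cong (λ y → c * (η * y)) (trans (ℕ→ℚ-homo-+ (δ ℕ.* i) _) (cong (_+ _) (ℕ→ℚ-homo-* δ i))))
      (solve 5 (λ c η δ i y → c :* (η :* (δ :* i :+ y)) := c :* (η :* y) :+ i :* (c :* (η :* δ))) refl
        c η (ℕ→ℚ δ) (ℕ→ℚ i) (ℕ→ℚ (lookup p t))))
  entry∈ : ∀ i → i ≤ k → InInterval ε (g (lookup (x i) t))
  entry∈ i i≤k = let l , h = lookup⁺ (x-bounded i i≤k) t in proj₂ (proj₂ scaling) _ l h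
  progression∈ : ∀ i → i ≤ k → InInterval ε (a + ℕ→ℚ i * d)
  -- The factor at `t` is below `ε` and the remaining factors are at most 1.
  progression∈ i i≤k = subst (InInterval ε)
    (trans (*-comm _ c) (trans (cong (λ y → c * g y) (lookup∘updateAt t p))
      (trans (sym (moving-updateAt (δ ℕ.* i ℕ.+_) t p T t-active)) (progression i))))
    (*-interval (entry∈ i i≤k) (movingExcept-unit unit t p-bounded T))
  a∈ : InInterval ε a
  a∈ = subst (InInterval ε) (trans (cong (a +_) (*-zeroˡ d)) (+-identityʳ a)) (progression∈ 0 z≤n)
  0<d : 0ℚ < d
  0<d = *-positive (proj₁ (movingExcept-unit unit t p-bounded T))
    (*-positive (proj₁ (proj₂ scaling)) (ℕ→ℚ-positive δ≥1))
  d∈ : InInterval ε d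
  -- The term with i = 1, available because k ≥ 1, bounds `d` through d < a + d < ε.
  d∈ = 0<d , <-trans (subst₂ _<_ (+-identityˡ d) (cong (a +_) (sym (*-identityˡ d))) (+-monoˡ-< d (proj₁ a∈)))
    (proj₂ (progression∈ 1 k≥1))
  1≤M : 1 ≤ M
  1≤M = let l , h = lookup⁺ p-bounded t in ℕ.≤-trans l h
  b∈ : InInterval ε b
  b∈ = *-interval (proj₂ (proj₂ scaling) 1 ℕ.≤-refl 1≤M) (fixed-unit unit p-bounded T)
  term∈ : ∀ i j → i ≤ k → InInterval ε (b * (a + ℕ→ℚ i * d) ^ℚ j)
  term∈ i j i≤k = let 0<y , y<ε = progression∈ i i≤k in *-interval b∈ (^-unit j (0<y , <⇒≤ (<-trans y<ε ε<1)))
  coloured : ∀ i j → i ≤ k → j ≤ k → χ′ (b * (a + ℕ→ℚ i * d) ^ℚ j) ≡ col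
  -- First `x i` is replaced by `p` at a fixed word, by equality of induced colourings; then the
  -- word moves along `L`, which is monochromatic for `p`.
  coloured i j i≤k j≤k = trans (cong χ′ (sym expand))
    (trans (code-injective (colouring (x i)) (colouring p) (proj₂ (same t i i≤k)) (L at ĵ)) (L-mono ĵ zero))
    where
    ĵ = fromℕ< (s≤s j≤k)
    expand : g 1 * weight (x i) (L at ĵ) ≡ b * (a + ℕ→ℚ i * d) ^ℚ j
    expand = trans (cong (g 1 *_) (weight-fill (x i) T ĵ))
      (trans (sym (*-assoc (g 1) _ _))
        (cong₂ _*_ (cong (g 1 *_) (fixed-updateAt _ t p T t-active))
          (cong₂ _^ℚ_ (progression i) (toℕ-fromℕ< (s≤s j≤k)))))
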